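{- Let $y_n$ denote the number of unlabelled rooted trees (Pólya trees) with $n$ vertices and $y(x)=\sum_{n\ge1}y_nx^n$. Then there is no formal power series $\phi(z)=\sum_{j\ge0}\phi_jz^j$ with non-negative coefficients $\phi_j\ge 0$ such that $y(x)=x\,\phi(y(x))$. In other words, Pólya trees are not simply generated.
   Context: A Pólya tree is an unlabelled rooted tree, i.e. rooted trees are counted up to root-preserving isomorphism. The generating function satisfies $y(x)=x\exp\left(\sum_{i\ge1}y(x^i)/i\right)$, and $y(x)=x+x^2+2x^3+4x^4+9x^5+\cdots$. A class of trees is called simply generated if its generating function $y(x)$ satisfies $y(x)=x\phi(y(x))$ for some power series $\phi$ with non-negative coefficients. -}

module Defs where

open import Algebra.Bundles using (CommutativeRing)
open import Data.Bool using (Bool; false; T)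
open import Data.Fin using (Fin; toℕ)
open import Data.Fin.Permutation using (Permutation′; _⟨$⟩ʳ_; _⟨$⟩ˡ_; inverseʳ; _∘ₚ_) renaming (id to idₚ; flip to flipₚ)
open import Data.List using (List; _∷_; _∷ʳ_; length)
open import Data.List.Relation.Unary.Linked using (Linked)
open import Data.List.Relation.Unary.Unique.Propositional using (Unique)
open import Data.Nat as ℕ using (ℕ; zero; suc; _∸_)
open import Data.Product using (_×_; ∃-syntax)
open import Function.Bundles using (Bijection)
open import Level using (0ℓ; _⊔_) renaming (suc to lsuc)
open import Relation.Binary using (Rel; IsPartialOrder; IsEquivalence; Setoid)
open import Relation.Binary.Construct.Closure.ReflexiveTransitive using (Star)
open import Relation.Binary.PropositionalEquality as ≡ using (_≡_; refl; sym; trans; cong; cong₂)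
open import Relation.Nullary using (¬_)

module _ {n : ℕ} (_∼_ : Rel (Fin n) 0ℓ) where

  Connected : Set
  Connected = ∀ u v → Star _∼_ u v

  -- The closed walk u, vs, u is a cycle when it has at least three vertices
  -- and repeats none of them apart from the endpoint u.
  IsCycle : Fin n → List (Fin n) → Set
  IsCycle u vs = 2 ℕ.≤ length vs × Unique (u ∷ vs) × Linked _∼_ (u ∷ (vs ∷ʳ u))

  Acyclic : Set
  Acyclic = ∀ u vs → ¬ IsCycle u vs

record RootedTree (n : ℕ) : Set where
  field
    adj       : Fin n → Fin n → Bool
    symmetric : ∀ u v → adj u v ≡ adj v u
    loopless  : ∀ v → adj v v ≡ false
    connected : Connected (λ u v → T (adj u v))
    acyclic   : Acyclic (λ u v → T (adj u v))
    root      : Fin n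

record _≅_ {n : ℕ} (s t : RootedTree n) : Set where
  private
    module s = RootedTree s
    module t = RootedTree t
  field
    vertexMap : Permutation′ n
    adjacency : ∀ u v → t.adj (vertexMap ⟨$⟩ʳ u) (vertexMap ⟨$⟩ʳ v) ≡ s.adj u v
    preserves-root : vertexMap ⟨$⟩ʳ s.root ≡ t.root

≅-isEquivalence : ∀ n → IsEquivalence (_≅_ {n})
≅-isEquivalence n = record
  { refl  = record { vertexMap = idₚ ; adjacency = λ _ _ → refl ; preserves-root = refl }
  ; sym   = ≅-sym
  ; trans = ≅-trans
  }
  where
  open _≅_

  ≅-sym : {s t : RootedTree n} → s ≅ t → t ≅ s
  ≅-sym {s} {t} p = record
    { vertexMap = flipₚ π
    ; adjacency = λ u v → trans (sym (adjacency p (π ⟨$⟩ˡ u) (π ⟨$⟩ˡ v)))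
                                (cong₂ (RootedTree.adj t) (inverseʳ π) (inverseʳ π))
    ; preserves-root = trans (cong (π ⟨$⟩ˡ_) (sym (preserves-root p)))
                             (inverseʳ (flipₚ π))
    }
    where π = vertexMap p

  ≅-trans : {s t r : RootedTree n} → s ≅ t → t ≅ r → s ≅ r
  ≅-trans p q = record
    { vertexMap = vertexMap p ∘ₚ vertexMap q
    ; adjacency = λ u v → trans (adjacency q (vertexMap p ⟨$⟩ʳ u) (vertexMap p ⟨$⟩ʳ v))
                                (adjacency p u v)
    ; preserves-root = trans (cong (vertexMap q ⟨$⟩ʳ_) (preserves-root p)) (preserves-root q)
    }

-- Agda has no quotient types: the elements of this setoid, compared by _≅_,
-- are the unlabelled rooted trees with n vertices.
PólyaTree : ℕ → Setoid 0ℓ 0ℓ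
PólyaTree n = record { isEquivalence = ≅-isEquivalence n }

HasCardinality : Setoid 0ℓ 0ℓ → ℕ → Set
HasCardinality S k = Bijection (≡.setoid (Fin k)) S

-- Stands in for ℝ, which is an instance.  The order is only assumed partial,
-- with 0 ≤ 1 as an axiom, so that real numbers whose order is not decidable
-- are covered as well.
record OrderedCommutativeRing c ℓ₁ ℓ₂ : Set (lsuc (c ⊔ ℓ₁ ⊔ ℓ₂)) where
  infix 4 _≤_
  field
    commutativeRing : CommutativeRing c ℓ₁
  open CommutativeRing commutativeRing public
  field
    _≤_            : Rel Carrier ℓ₂
    isPartialOrder : IsPartialOrder _≈_ _≤_
    +-monoˡ-≤      : ∀ {x y} z → x ≤ y → (x + z) ≤ (y + z)
    *-nonNegative  : ∀ {x y} → 0# ≤ x → 0# ≤ y → 0# ≤ (x * y)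
    0≤1            : 0# ≤ 1#
    1≉0            : ¬ (1# ≈ 0#)

module FormalPowerSeries {c ℓ₁ ℓ₂} (R : OrderedCommutativeRing c ℓ₁ ℓ₂) where
  open OrderedCommutativeRing R
  open import Algebra.Definitions.RawMonoid +-rawMonoid using (sum) renaming (_×_ to _·_)

  -- f n is the coefficient of xⁿ.
  PowerSeries : Set c
  PowerSeries = ℕ → Carrier

  _≈ₛ_ : Rel PowerSeries ℓ₁
  f ≈ₛ g = ∀ n → f n ≈ g n

  1ₛ : PowerSeries
  1ₛ zero    = 1#
  1ₛ (suc _) = 0#

  _*ₛ_ : PowerSeries → PowerSeries → PowerSeries
  (f *ₛ g) n = sum {suc n} λ i → f (toℕ i) * g (n ∸ toℕ i)

  _^ₛ_ : PowerSeries → ℕ → PowerSeries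
  f ^ₛ zero  = 1ₛ
  f ^ₛ suc j = f *ₛ (f ^ₛ j)

  x*_ : PowerSeries → PowerSeries
  (x* f) zero    = 0#
  (x* f) (suc n) = f n

  -- φ(f) = Σⱼ φⱼ fʲ, meaningful only when f has zero constant term: then fʲ
  -- contributes nothing to the coefficient of xⁿ for j > n.
  _⟨_⟩ : PowerSeries → PowerSeries → PowerSeries
  (φ ⟨ f ⟩) n = sum {suc n} λ j → φ (toℕ j) * (f ^ₛ toℕ j) n

  -- Σ_{n≥1} yₙ xⁿ
  generatingFunction : (ℕ → ℕ) → PowerSeries
  generatingFunction y zero    = 0#
  generatingFunction y (suc n) = y (suc n) · 1#

  SimplyGenerated : (ℕ → ℕ) → Set (c ⊔ ℓ₁ ⊔ ℓ₂)
  SimplyGenerated y = ∃[ φ ] (∀ j → 0# ≤ φ j) × Y ≈ₛ (x* (φ ⟨ Y ⟩))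
    where Y = generatingFunction y

{-# OPTIONS --safe #-}
-- There are 1, 1, 2, 4, 9, 20 Pólya trees with 1, …, 6 vertices.  Comparing coefficients in
-- y(x) = x φ(y(x)) with these values determines φ₀, …, φ₅ and gives φ₅ = −1.
--
-- The numbers are obtained recursively.  Every tree with at least two vertices arises by
-- attaching a leaf to a smaller one, so it suffices to attach a leaf in all possible ways to
-- representatives of the smaller trees and to search for isomorphisms among the results.
-- Representatives are told apart by the numbers of walks of length 1, …, 5 from the root.
module Submission where

open import Defs
open import Algebra.Properties.Ring using (+-cancelʳ)
import Algebra.Solver.Ring.NaturalCoefficients.Default
open import Data.Bool using (Bool; false; T; if_then_else_)
open import Data.Bool.Properties using (T?) renaming (_≟_ to _≟ᵇ_)
open import Data.Empty using (⊥-elim)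
open import Data.Fin using (Fin; zero; suc; toℕ; punchIn; punchOut; _≟_)
open import Data.Fin.Patterns using (0F; 1F; 2F; 3F; 4F; 5F; 6F; 7F; 8F)
open import Data.Fin.Permutation as Perm using (Permutation′; _⟨$⟩ʳ_; insert; lift₀; insert-punchIn)
open import Data.Fin.Properties using (injective⇒≤; cantor-schröder-bernstein; punchInᵢ≢i; punchIn-injective; punchIn-punchOut; punchOut-cong; punchOut-punchIn; all?; any?)
open import Data.List using (List; []; _∷_; _++_; _∷ʳ_; length; lookup; map; concatMap; allFin; initLast; _∷ʳ′_)
open import Data.List.Membership.DecPropositional using (_∈?_)
open import Data.List.Membership.Propositional using (_∈_; _∉_)
open import Data.List.Membership.Propositional.Properties using (∈-∃++; ∈-lookup; ∈-++⁺ʳ)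
open import Data.List.Properties using (++-assoc; map-++; length-map)
open import Data.List.Relation.Binary.Permutation.Propositional using (_↭_; ↭⇒↭ₛ)
open import Data.List.Relation.Binary.Permutation.Propositional.Properties using (shift; ++-comm; ↭-length)
import Data.List.Relation.Binary.Permutation.Setoid.Properties as ↭ₛ
open import Data.List.Relation.Unary.All as All using ([]; _∷_)
import Data.List.Relation.Unary.All.Properties as All
open import Data.List.Relation.Unary.AllPairs using (AllPairs; []; _∷_)
open import Data.List.Relation.Unary.Any as Any using (here; there)
open import Data.List.Relation.Unary.Linked using (Linked; []; [-]; _∷_)
import Data.List.Relation.Unary.Linked.Properties as Linked
open import Data.List.Relation.Unary.Unique.Propositional using (Unique)
import Data.List.Relation.Unary.Unique.Propositional.Properties as Unique
open import Data.Nat using (ℕ; zero; suc; _+_; _∸_; _≤_; z≤n; s≤s)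
open import Data.Nat.Properties using (+-0-commutativeMonoid; +-suc; +-comm; 1+n≰n; suc-injective) renaming (_≟_ to _≟ⁿ_)
open import Algebra.Properties.CommutativeMonoid.Sum +-0-commutativeMonoid using (sum; sum-permute; sum-cong-≗)
open import Data.Product using (_×_; _,_; proj₁; proj₂; ∃-syntax)
open import Data.Vec as Vec using (Vec; []; _∷_)
open import Data.Vec.Functional using (foldr)
open import Data.Vec.Properties using (≡-dec; map-cong)
open import Function using (_∘_; Injective)
open import Function.Bundles using (Bijection; Injection; mk⇔)
open import Function.Properties.Inverse using (↔⇒↣)
open import Level using (Level; 0ℓ)
open import Relation.Binary using (Rel; Setoid; Symmetric; IsEquivalence; IsPartialOrder)
open import Relation.Binary.Construct.Closure.ReflexiveTransitive using (Star; ε; _◅_; _◅◅_; gmap; kleisliStar; reverse)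
open import Relation.Binary.PropositionalEquality using (_≡_; _≢_; refl; sym; trans; cong; cong₂; subst; subst₂; setoid)
open import Relation.Nullary using (¬_; Dec; yes; no; contradiction; _×-dec_; _→-dec_; ¬?)
open import Relation.Nullary.Decidable using (True; toWitness; fromWitness; ⌊_⌋; isYes≗does; does-⇔)

private variable
  a ℓ : Level
  A : Set a
  n k l : ℕ

-- Paths and cycles

-- The cut vertex `y` is kept in both pieces, so that no edge of the path is lost.
Linked-++⁻ : ∀ {R : Rel A ℓ} xs {y ys} → Linked R (xs ++ y ∷ ys) → Linked R (xs ∷ʳ y) × Linked R (y ∷ ys)
Linked-++⁻ []           Rys        = [-] , Rys
Linked-++⁻ (x ∷ [])     (r ∷ Rys)  = r ∷ [-] , Rys
Linked-++⁻ (x ∷ z ∷ xs) (r ∷ Rzys) with Rzs , Rys ← Linked-++⁻ (z ∷ xs) Rzys = r ∷ Rzs , Rys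

Linked-++⁺ : ∀ {R : Rel A ℓ} xs {y ys} → Linked R (xs ∷ʳ y) → Linked R (y ∷ ys) → Linked R (xs ++ y ∷ ys)
Linked-++⁺ []           _         Rys = Rys
Linked-++⁺ (x ∷ [])     (r ∷ _)   Rys = r ∷ Rys
Linked-++⁺ (x ∷ z ∷ xs) (r ∷ Rzs) Rys = r ∷ Linked-++⁺ (z ∷ xs) Rzs Rys

AllPairs-++⁻ˡ : ∀ {R : Rel A ℓ} xs {ys} → AllPairs R (xs ++ ys) → AllPairs R xs
AllPairs-++⁻ˡ []       _         = []
AllPairs-++⁻ˡ (x ∷ xs) (px ∷ ps) = All.++⁻ˡ xs px ∷ AllPairs-++⁻ˡ xs ps

Unique-resp-↭ : {xs ys : List A} → xs ↭ ys → Unique xs → Unique ys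
Unique-resp-↭ {A = A} p = ↭ₛ.Unique-resp-↭ (setoid A) (↭⇒↭ₛ p)

Unique⇒lookup-injective : {xs : List A} → Unique xs → Injective _≡_ _≡_ (lookup xs)
Unique⇒lookup-injective (_  ∷ _) {zero}  {zero}  _  = refl
Unique⇒lookup-injective (px ∷ _) {zero}  {suc j} eq = contradiction eq (All.lookup px (∈-lookup j))
Unique⇒lookup-injective (px ∷ _) {suc i} {zero}  eq = contradiction (sym eq) (All.lookup px (∈-lookup i))
Unique⇒lookup-injective (_  ∷ u) {suc i} {suc j} eq = cong suc (Unique⇒lookup-injective u eq)

Unique⇒length≤ : {xs : List (Fin n)} → Unique xs → length xs ≤ n
Unique⇒length≤ u = injective⇒≤ (Unique⇒lookup-injective u)

module _ {R : Rel (Fin n) 0ℓ} where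

  -- The closed walk u, as, v, bs, u read from v is v, bs, u, as, v: its two halves change places at
  -- v and u, and the vertex list is merely permuted.
  rotate : ∀ {u v vs} → v ∈ vs → IsCycle R u vs → ∃[ ws ] IsCycle R v ws
  rotate {u} {v} v∈vs cyc with as , bs , refl ← ∈-∃++ v∈vs
    with 2≤ , uniq , linked ← cyc =
    bs ++ u ∷ as ,
    subst (2 ≤_) (suc-injective (↭-length rotated)) 2≤ ,
    Unique-resp-↭ rotated uniq ,
    subst (λ xs → Linked R (v ∷ xs)) (sym (++-assoc bs (u ∷ as) (v ∷ [])))
      (Linked-++⁺ (v ∷ bs) (proj₂ parts) (proj₁ parts))
    where
    parts = Linked-++⁻ (u ∷ as) (subst (λ xs → Linked R (u ∷ xs)) (++-assoc as (v ∷ bs) (u ∷ [])) linked)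
    rotated = ++-comm (u ∷ as) (v ∷ bs)

  -- The second and the last-but-one vertex of a cycle at `u` are both neighbours of `u`, hence both
  -- equal `p`; but they are distinct, since a cycle has at least two vertices besides `u`.
  leaf-¬IsCycle : ∀ {u p} → (∀ {w} → R u w → w ≡ p) → (∀ {w} → R w u → w ≡ p) → ∀ vs → ¬ IsCycle R u vs
  leaf-¬IsCycle out inn (a ∷ bs) cyc with initLast bs
  leaf-¬IsCycle out inn (a ∷ _) (s≤s () , _) | []
  leaf-¬IsCycle {u} out inn (a ∷ _) (_ , _ ∷ a∉ ∷ _ , e ∷ linked) | cs ∷ʳ′ c
    with _ , e′ ∷ _ ← Linked-++⁻ (a ∷ cs) (subst (λ xs → Linked R (a ∷ xs)) (++-assoc cs (c ∷ []) (u ∷ [])) linked)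
    = All.lookup a∉ (∈-++⁺ʳ cs (here refl)) (trans (out e) (sym (inn e′)))

-- Attaching a leaf

open RootedTree
open _≅_
open module ≅ {n} = IsEquivalence (≅-isEquivalence n) using () renaming (refl to ≅-refl; sym to ≅-sym; trans to ≅-trans)

module _ (t : RootedTree n) where

  Edge : Rel (Fin n) 0ℓ
  Edge u v = T (adj t u v)

  Edge-sym : Symmetric Edge
  Edge-sym {u} {v} = subst T (symmetric t u v)

  Edge⇒≢ : ∀ {u v} → Edge u v → u ≢ v
  Edge⇒≢ {u} e refl = subst T (loopless t u) e

∉⇒map-suc : (xs : List (Fin (suc n))) → zero ∉ xs → ∃[ ys ] xs ≡ map suc ys
∉⇒map-suc []           _  = [] , refl
∉⇒map-suc (zero ∷ xs)  0∉ = contradiction (here refl) 0∉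
∉⇒map-suc (suc x ∷ xs) 0∉ with ys , refl ← ∉⇒map-suc xs (0∉ ∘ there) = x ∷ ys , refl

-- The new leaf is vertex 0.
attach : RootedTree n → Fin n → RootedTree (suc n)
attach {n} t p = record
  { adj       = adj′
  ; symmetric = symmetric′
  ; loopless  = loopless′
  ; connected = connected′
  ; acyclic   = acyclic′
  ; root      = suc (root t)
  }
  where
  adj′ : Fin (suc n) → Fin (suc n) → Bool
  adj′ zero    zero    = false
  adj′ zero    (suc v) = ⌊ v ≟ p ⌋
  adj′ (suc u) zero    = ⌊ u ≟ p ⌋
  adj′ (suc u) (suc v) = adj t u v

  Edge′ : Rel (Fin (suc n)) 0ℓ
  Edge′ u v = T (adj′ u v)

  symmetric′ : ∀ u v → adj′ u v ≡ adj′ v u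
  symmetric′ zero    zero    = refl
  symmetric′ zero    (suc v) = refl
  symmetric′ (suc u) zero    = refl
  symmetric′ (suc u) (suc v) = symmetric t u v

  loopless′ : ∀ v → adj′ v v ≡ false
  loopless′ zero    = refl
  loopless′ (suc v) = loopless t v

  sym′ : Symmetric Edge′
  sym′ {u} {v} = subst T (symmetric′ u v)

  from-p : ∀ v → Star Edge′ (suc p) v
  from-p zero    = fromWitness refl ◅ ε
  from-p (suc v) = gmap suc (λ e → e) (connected t p v)

  connected′ : Connected Edge′
  connected′ u v = reverse (λ {u} {v} → sym′ {u} {v}) (from-p u) ◅◅ from-p v

  out : ∀ {w} → Edge′ zero w → w ≡ suc p
  out {suc w} e = cong suc (toWitness e)

  0∉cycle : ∀ {vs} → ¬ IsCycle Edge′ zero vs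
  0∉cycle {vs} = leaf-¬IsCycle out (λ {w} e → out (sym′ {w} {zero} e)) vs

  acyclic′ : Acyclic Edge′
  acyclic′ zero    vs cyc = 0∉cycle cyc
  acyclic′ (suc u) vs cyc with _∈?_ _≟_ zero vs
  -- A cycle through the new leaf can be rotated to start there; any other cycle already lies in the
  -- old tree.
  ... | yes 0∈vs = 0∉cycle (proj₂ (rotate 0∈vs cyc))
  ... | no  0∉vs with ws , refl ← ∉⇒map-suc vs 0∉vs with 2≤ , uniq , linked ← cyc =
    acyclic t u ws
      ( subst (2 ≤_) (length-map suc ws) 2≤
      , Unique.map⁻ uniq
      , Linked.map⁻ (subst (λ xs → Linked Edge′ (suc u ∷ xs)) (sym (map-++ suc ws (u ∷ []))) linked))

attach-cong : {s t : RootedTree n} (s≅t : s ≅ t) (p : Fin n) → attach s p ≅ attach t (vertexMap s≅t ⟨$⟩ʳ p)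
attach-cong {s = s} {t} s≅t p = record
  { vertexMap      = lift₀ π
  ; adjacency      = adjacency′
  ; preserves-root = cong suc (preserves-root s≅t)
  }
  where
  π = vertexMap s≅t

  ⌊⌋-π : ∀ v → ⌊ (π ⟨$⟩ʳ v) ≟ (π ⟨$⟩ʳ p) ⌋ ≡ ⌊ v ≟ p ⌋
  ⌊⌋-π v = trans (isYes≗does _) (trans
    (does-⇔ (mk⇔ (Injection.injective (↔⇒↣ π)) (cong (π ⟨$⟩ʳ_))) (_ ≟ _) (v ≟ p)) (sym (isYes≗does (v ≟ p))))

  adjacency′ : ∀ u v → adj (attach t (π ⟨$⟩ʳ p)) (lift₀ π ⟨$⟩ʳ u) (lift₀ π ⟨$⟩ʳ v) ≡ adj (attach s p) u v
  adjacency′ zero    zero    = refl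
  adjacency′ zero    (suc v) = ⌊⌋-π v
  adjacency′ (suc u) zero    = ⌊⌋-π u
  adjacency′ (suc u) (suc v) = adjacency s≅t u v

-- Removing a leaf

-- The parent is indexed by `Fin n`, so it is directly a vertex of the tree that remains after
-- deletion. The leaf differs from the root so that the root survives.
record Leaf (t : RootedTree (suc n)) : Set where
  field
    leaf      : Fin (suc n)
    parent    : Fin n
    leaf≢root : leaf ≢ root t
    edge      : Edge t leaf (punchIn leaf parent)
    unique    : ∀ {w} → Edge t leaf w → w ≡ punchIn leaf parent

module _ (t : RootedTree (suc n)) where

  -- A non-backtracking path from the root, listed from its current end: the end v is a leaf,
  -- or has another neighbour, which lies off the path because there are no cycles.
  extend-to-leaf : ∀ fuel v p ps → fuel + length (v ∷ p ∷ ps) ≡ suc (suc n) → root t ∈ p ∷ ps →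
                   Unique (v ∷ p ∷ ps) → Linked (Edge t) (v ∷ p ∷ ps) → Leaf t
  -- Out of fuel, the path would have one more distinct vertex than the tree.
  extend-to-leaf zero v p ps len _ uniq _ =
    contradiction (subst (_≤ suc n) len (Unique⇒length≤ uniq)) 1+n≰n
  extend-to-leaf (suc fuel) v p ps len root∈ uniq@(v∉ ∷ _) linked@(v~p ∷ _)
    with any? (λ w → T? (adj t v w) ×-dec ¬? (w ≟ p))
  ... | no none = record
    { leaf      = v
    ; parent    = punchOut v≢p
    ; leaf≢root = All.lookup v∉ root∈
    ; edge      = subst (Edge t v) (sym (punchIn-punchOut v≢p)) v~p
    ; unique    = λ {w} v~w → trans (only-p w v~w) (sym (punchIn-punchOut v≢p))
    }
    where
    v≢p : v ≢ p
    v≢p = All.head v∉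
    only-p : ∀ w → Edge t v w → w ≡ p
    only-p w v~w with w ≟ p
    ... | yes w≡p = w≡p
    ... | no  w≢p = contradiction (w , v~w , w≢p) none
  ... | yes (w , v~w , w≢p) with _∈?_ _≟_ w (v ∷ p ∷ ps)
  ... | no w∉ =
    extend-to-leaf fuel w v (p ∷ ps) (trans (+-suc fuel _) len) (there root∈)
      (All.¬Any⇒All¬ _ w∉ ∷ uniq) (Edge-sym t v~w ∷ linked)
  ... | yes (here refl)         = contradiction refl (Edge⇒≢ t v~w)
  ... | yes (there (here w≡p))  = contradiction w≡p w≢p
  -- The path from `v` back to `w`, closed up by the edge between them, would be a cycle.
  ... | yes (there (there w∈ps)) with as , bs , refl ← ∈-∃++ w∈ps =
    ⊥-elim (acyclic t w (v ∷ p ∷ as)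
      ( s≤s (s≤s z≤n)
      , AllPairs-++⁻ˡ (w ∷ v ∷ p ∷ as) (Unique-resp-↭ (shift w (v ∷ p ∷ as) bs) uniq)
      , Edge-sym t v~w ∷ proj₁ (Linked-++⁻ (v ∷ p ∷ as) linked)))

-- A walk from the root to some other vertex has a first edge, and this edge is the initial path to
-- be extended.
has-leaf : (t : RootedTree (suc (suc n))) → Leaf t
has-leaf {n} t = go (connected t (root t) (punchIn (root t) zero)) refl
  where
  go : ∀ {w} → Star (Edge t) (root t) w → w ≡ punchIn (root t) zero → Leaf t
  go ε                 eq = contradiction (sym eq) (punchInᵢ≢i (root t) zero)
  go (_◅_ {j = v} e _) _  = extend-to-leaf t (suc n) v (root t) [] (+-comm (suc n) 2) (here refl)
    ((Edge⇒≢ t (Edge-sym t e) ∷ []) ∷ [] ∷ []) (Edge-sym t e ∷ [-])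

module _ (t : RootedTree (suc n)) (lf : Leaf t) where
  open Leaf lf

  private
    Edge⁻ : Rel (Fin n) 0ℓ
    Edge⁻ u v = Edge t (punchIn leaf u) (punchIn leaf v)

    -- Folding the leaf onto its parent turns walks into walks that avoid the leaf.
    retract : Fin (suc n) → Fin n
    retract v with leaf ≟ v
    ... | yes _      = parent
    ... | no  leaf≢v = punchOut leaf≢v

    retract-punchIn : ∀ v → retract (punchIn leaf v) ≡ v
    retract-punchIn v with leaf ≟ punchIn leaf v
    ... | yes eq = contradiction (sym eq) (punchInᵢ≢i leaf v)
    ... | no  ne = trans (punchOut-cong leaf refl) (punchOut-punchIn leaf)

    punchOut-parent : ∀ {w} (leaf≢w : leaf ≢ w) → Edge t leaf w → punchOut leaf≢w ≡ parent
    punchOut-parent _ e with refl ← unique e = trans (punchOut-cong leaf refl) (punchOut-punchIn leaf)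

    retract-edge : ∀ {u v} → Edge t u v → Star Edge⁻ (retract u) (retract v)
    retract-edge {u} {v} e with leaf ≟ u | leaf ≟ v
    ... | yes refl | yes refl = ε
    ... | yes refl | no  ne   = subst (Star Edge⁻ parent) (sym (punchOut-parent ne e)) ε
    ... | no  ne   | yes refl = subst (λ w → Star Edge⁻ w parent) (sym (punchOut-parent ne (Edge-sym t e))) ε
    ... | no  neᵤ  | no  neᵥ  = subst₂ (Edge t) (sym (punchIn-punchOut neᵤ)) (sym (punchIn-punchOut neᵥ)) e ◅ ε

  removeLeaf : RootedTree n
  removeLeaf = record
    { adj       = λ u v → adj t (punchIn leaf u) (punchIn leaf v)
    ; symmetric = λ u v → symmetric t _ _
    ; loopless  = λ v → loopless t _
    ; connected = λ u v → subst₂ (Star Edge⁻) (retract-punchIn u) (retract-punchIn v)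
                            (kleisliStar retract retract-edge (connected t (punchIn leaf u) (punchIn leaf v)))
    ; acyclic   = λ u vs (2≤ , uniq , linked) → acyclic t (punchIn leaf u) (map (punchIn leaf) vs)
                    ( subst (2 ≤_) (sym (length-map (punchIn leaf) vs)) 2≤
                    , Unique.map⁺ (punchIn-injective leaf _ _) uniq
                    , subst (λ xs → Linked (Edge t) (punchIn leaf u ∷ xs)) (map-++ (punchIn leaf) vs (u ∷ []))
                        (Linked.map⁺ linked))
    ; root      = punchOut leaf≢root
    }

  ≅-attach-removeLeaf : t ≅ attach removeLeaf parent
  ≅-attach-removeLeaf = ≅-sym record
    { vertexMap      = π
    ; adjacency      = adjacency′
    ; preserves-root = trans (insert-punchIn zero leaf Perm.id (punchOut leaf≢root)) (punchIn-punchOut leaf≢root)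
    }
    where
    π : Permutation′ (suc n)
    -- Sends 0 to `leaf` and `suc v` to `punchIn leaf v`, undoing the renumbering caused by
    -- deletion.
    π = insert zero leaf Perm.id

    adj-leaf : ∀ v → adj t leaf (punchIn leaf v) ≡ ⌊ v ≟ parent ⌋
    adj-leaf v = trans
      (does-⇔ (mk⇔ (λ e → punchIn-injective leaf _ _ (unique e)) (λ { refl → edge })) (T? _) (v ≟ parent))
      (sym (isYes≗does (v ≟ parent)))

    adjacency′ : ∀ u v → adj t (π ⟨$⟩ʳ u) (π ⟨$⟩ʳ v) ≡ adj (attach removeLeaf parent) u v
    adjacency′ zero    zero    = loopless t leaf
    adjacency′ zero    (suc v) = adj-leaf v
    adjacency′ (suc u) zero    = trans (symmetric t _ leaf) (adj-leaf u)
    adjacency′ (suc u) (suc v) = refl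

-- Counting walks

walks : RootedTree n → ℕ → Fin n → ℕ
walks t zero    v = 1
walks t (suc k) v = sum λ u → if adj t v u then walks t k u else 0

-- Induction on the length, reindexing the sum over the second vertex of the walk along the
-- isomorphism.
walks-≅ : {s t : RootedTree n} (s≅t : s ≅ t) → ∀ k v → walks t k (vertexMap s≅t ⟨$⟩ʳ v) ≡ walks s k v
walks-≅ s≅t zero    v = refl
walks-≅ {s = s} {t} s≅t (suc k) v = trans
  (sum-permute (λ u → if adj t (π ⟨$⟩ʳ v) u then walks t k u else 0) π)
  (sum-cong-≗ λ u → cong₂ (λ b w → if b then w else 0) (adjacency s≅t v u) (walks-≅ s≅t k u))
  where π = vertexMap s≅t

walkLengths : Vec ℕ 5
walkLengths = 1 ∷ 2 ∷ 3 ∷ 4 ∷ 5 ∷ []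

rootWalks : RootedTree n → Vec ℕ 5
rootWalks t = Vec.map (λ k → walks t k (root t)) walkLengths

rootWalks-≅ : {s t : RootedTree n} → s ≅ t → rootWalks s ≡ rootWalks t
rootWalks-≅ {s = s} {t} s≅t = map-cong
  (λ k → trans (sym (walks-≅ s≅t k (root s))) (cong (walks t k) (preserves-root s≅t))) walkLengths

-- Enumerating isomorphism classes

-- A permutation is determined by the image `j` of 0 together with a bijection between the remaining
-- points.
permutations : ∀ n → List (Permutation′ n)
permutations zero    = Perm.id ∷ []
permutations (suc n) = concatMap (λ j → map (insert zero j) (permutations n)) (allFin (suc n))

IsIsomorphism : (s t : RootedTree n) → Permutation′ n → Set
IsIsomorphism s t π = π ⟨$⟩ʳ root s ≡ root t × (∀ u v → adj t (π ⟨$⟩ʳ u) (π ⟨$⟩ʳ v) ≡ adj s u v)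

isIsomorphism? : (s t : RootedTree n) → ∀ π → Dec (IsIsomorphism s t π)
isIsomorphism? s t π = (_ ≟ _) ×-dec all? λ u → all? λ v → _ ≟ᵇ _

-- Equality of the walk counts is implied; testing it first avoids most of the search.
Matching : (s t : RootedTree n) → Set
Matching {n} s t = rootWalks s ≡ rootWalks t × Any.Any (IsIsomorphism s t) (permutations n)

matching? : (s t : RootedTree n) → Dec (Matching s t)
matching? s t = ≡-dec _≟ⁿ_ _ _ ×-dec Any.any? (isIsomorphism? s t) _

Matching⇒≅ : {s t : RootedTree n} → Matching s t → s ≅ t
Matching⇒≅ (_ , any) with π , fixes-root , adjacent ← Any.satisfied any = record
  { vertexMap = π ; adjacency = adjacent ; preserves-root = fixes-root }

-- An entry (i , v) of extensions stands for rep i with a leaf attached to its vertex v.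
module _ (rep : Fin k → RootedTree (suc n)) (extensions : Vec (Fin k × Fin (suc n)) l) where

  extend : Fin l → RootedTree (suc (suc n))
  extend j = let i , v = Vec.lookup extensions j in attach (rep i) v

  Exhaustive : Set
  Exhaustive = ∀ i v → ∃[ j ] Matching (attach (rep i) v) (extend j)

  exhaustive? : Dec Exhaustive
  exhaustive? = all? λ i → all? λ v → any? λ j → matching? (attach (rep i) v) (extend j)

  Separated : Set
  Separated = ∀ i j → rootWalks (extend i) ≡ rootWalks (extend j) → i ≡ j

  separated? : Dec Separated
  separated? = all? λ i → all? λ j → ≡-dec _≟ⁿ_ _ _ →-dec (i ≟ j)

-- Injectivity: isomorphic extensions have equal walk counts, which `separated?` rules out for
-- distinct indices. Surjectivity: delete a leaf, pass to the representative of the smaller tree,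
-- reattach the leaf, and look the result up with `exhaustive?`. Both implicit arguments are filled
-- by evaluating the decision procedures.
extendCardinality : (c : HasCardinality (PólyaTree (suc n)) k) (extensions : Vec (Fin k × Fin (suc n)) l) →
                    {True (exhaustive? (Bijection.to c) extensions)} → {True (separated? (Bijection.to c) extensions)} →
                    HasCardinality (PólyaTree (suc (suc n))) l
extendCardinality c extensions {exhaustive} {separated} = record
  { to        = extend rep extensions
  ; cong      = λ { refl → ≅-refl }
  ; bijective = (λ {i} {j} eq → toWitness separated i j (rootWalks-≅ eq)) , surjective
  }
  where
  rep = Bijection.to c

  surjective : ∀ t → ∃[ j ] (∀ {i} → i ≡ j → extend rep extensions i ≅ t)
  surjective t = j , λ { refl → ≅-sym t≅ }
    where
    lf = has-leaf t
    s  = removeLeaf t lf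
    s≅ : s ≅ rep (proj₁ (Bijection.surjective c s))
    s≅ = ≅-sym (proj₂ (Bijection.surjective c s) refl)
    found = toWitness exhaustive (proj₁ (Bijection.surjective c s)) (vertexMap s≅ ⟨$⟩ʳ Leaf.parent lf)
    j = proj₁ found
    t≅ : t ≅ extend rep extensions j
    t≅ = ≅-trans (≅-attach-removeLeaf t lf) (≅-trans (attach-cong s≅ (Leaf.parent lf)) (Matching⇒≅ (proj₂ found)))

singleton : RootedTree 1
singleton = record
  { adj       = λ _ _ → false
  ; symmetric = λ _ _ → refl
  ; loopless  = λ _ → refl
  ; connected = λ { 0F 0F → ε }
  ; acyclic   = λ { _ (_ ∷ _) (_ , _ , () ∷ _) }
  ; root      = 0F
  }

-- Following one bijection by a section of the other gives injections between the two finite sets in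
-- both directions.
HasCardinality-unique : {S : Setoid 0ℓ 0ℓ} → HasCardinality S k → HasCardinality S l → k ≡ l
HasCardinality-unique {S = S} f g = cantor-schröder-bernstein (compare-injective f g) (compare-injective g f)
  where
  module S = Setoid S

  compare : ∀ {m m′} → HasCardinality S m → HasCardinality S m′ → Fin m → Fin m′
  compare f g i = proj₁ (Bijection.surjective g (Bijection.to f i))

  compare-injective : ∀ {m m′} (f : HasCardinality S m) (g : HasCardinality S m′) → Injective _≡_ _≡_ (compare f g)
  compare-injective f g {i} {j} eq = Bijection.injective f
    (S.trans (S.sym (proj₂ (Bijection.surjective g (Bijection.to f i)) refl)) (proj₂ (Bijection.surjective g (Bijection.to f j)) eq))

cardinality₁ : HasCardinality (PólyaTree 1) 1
cardinality₁ = record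
  { to        = λ _ → singleton
  ; cong      = λ _ → ≅-refl
  ; bijective = (λ { {0F} {0F} _ → refl }) , λ t → 0F , λ _ → record
    { vertexMap      = Perm.id
    ; adjacency      = λ { 0F 0F → loopless t 0F }
    ; preserves-root = 0F-unique (root t)
    }
  }
  where
  0F-unique : (i : Fin 1) → 0F ≡ i
  0F-unique 0F = refl

-- Here and below, the list contains the lexicographically first pair of each isomorphism class of
-- extensions.
cardinality₂ : HasCardinality (PólyaTree 2) 1
cardinality₂ = extendCardinality cardinality₁ ((0F , 0F) ∷ [])

cardinality₃ : HasCardinality (PólyaTree 3) 2
cardinality₃ = extendCardinality cardinality₂ ((0F , 0F) ∷ (0F , 1F) ∷ [])

cardinality₄ : HasCardinality (PólyaTree 4) 4
cardinality₄ = extendCardinality cardinality₃ ((0F , 0F) ∷ (0F , 1F) ∷ (0F , 2F) ∷ (1F , 2F) ∷ [])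

cardinality₅ : HasCardinality (PólyaTree 5) 9
cardinality₅ = extendCardinality cardinality₄
  ((0F , 0F) ∷ (0F , 1F) ∷ (0F , 2F) ∷ (0F , 3F) ∷ (1F , 2F) ∷ (1F , 3F) ∷ (2F , 0F) ∷ (2F , 3F) ∷ (3F , 3F) ∷ [])

cardinality₆ : HasCardinality (PólyaTree 6) 20
cardinality₆ = extendCardinality cardinality₅
  ( (0F , 0F) ∷ (0F , 1F) ∷ (0F , 2F) ∷ (0F , 3F) ∷ (0F , 4F) ∷ (1F , 2F) ∷ (1F , 3F) ∷ (1F , 4F) ∷ (2F , 0F) ∷ (2F , 3F)
  ∷ (2F , 4F) ∷ (3F , 0F) ∷ (3F , 4F) ∷ (4F , 3F) ∷ (4F , 4F) ∷ (5F , 0F) ∷ (5F , 4F) ∷ (6F , 4F) ∷ (7F , 4F) ∷ (8F , 4F) ∷ [])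

-- Comparing coefficients

module _ {c ℓ₁ ℓ₂} (R : OrderedCommutativeRing c ℓ₁ ℓ₂) where
  open OrderedCommutativeRing R
    hiding (zero) renaming (refl to ≈-refl; sym to ≈-sym; trans to ≈-trans; _+_ to _⊕_; _≤_ to _⊑_; setoid to ≈-setoid)
  open FormalPowerSeries R
  open import Algebra.Definitions.RawMonoid +-rawMonoid using () renaming (_×_ to _·_)
  open Algebra.Solver.Ring.NaturalCoefficients.Default commutativeSemiring using (Polynomial; con; _:+_; _:*_; _:=_; solve)

  private
    -- Syntactic copies of the operations on power series: a coefficient of a copy evaluates
    -- definitionally to the same coefficient of the original, as the solver requires.
    Series : ℕ → Set
    Series m = ℕ → Polynomial m

    :sum : ∀ {m} i → (Fin i → Polynomial m) → Polynomial m
    :sum _ = foldr _:+_ (con 0)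

    _:·_ : ∀ {m} → ℕ → Polynomial m → Polynomial m
    zero  :· p = con 0
    suc i :· p = p :+ (i :· p)

    _:^ₛ_ : ∀ {m} → Series m → ℕ → Series m
    (f :^ₛ zero)  zero    = con 1
    (f :^ₛ zero)  (suc _) = con 0
    (f :^ₛ suc j) i       = :sum (suc i) λ h → f (toℕ h) :* (f :^ₛ j) (i ∸ toℕ h)

    _:⟨_⟩ : ∀ {m} → Series m → Series m → Series m
    (φ :⟨ f ⟩) i = :sum (suc i) λ j → φ (toℕ j) :* (f :^ₛ toℕ j) i

    -- Coefficients from index 6 on do not occur and get arbitrary values.
    series : ∀ {m} (p₀ p₁ p₂ p₃ p₄ p₅ : Polynomial m) → Series m
    series p₀ p₁ p₂ p₃ p₄ p₅ 0 = p₀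
    series p₀ p₁ p₂ p₃ p₄ p₅ 1 = p₁
    series p₀ p₁ p₂ p₃ p₄ p₅ 2 = p₂
    series p₀ p₁ p₂ p₃ p₄ p₅ 3 = p₃
    series p₀ p₁ p₂ p₃ p₄ p₅ 4 = p₄
    series p₀ p₁ p₂ p₃ p₄ p₅ _ = p₅

    :Y : ∀ {m} → Series m
    :Y = series (con 0) (1 :· con 1) (1 :· con 1) (2 :· con 1) (4 :· con 1) (9 :· con 1)

  module _ (y : ℕ → ℕ) (y₁ : y 1 ≡ 1) (y₂ : y 2 ≡ 1) (y₃ : y 3 ≡ 2) (y₄ : y 4 ≡ 4) (y₅ : y 5 ≡ 9) where
    private Y = generatingFunction y

    -- The multipliers 1, −4, 3, 2, −1 eliminate φ₁, …, φ₄ from the coefficients of x⁵, …, x¹;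
    -- negative terms are moved to the other side so that this is a semiring identity.
    isolate-φ₅ : ∀ φ → (φ ⟨ Y ⟩) 5 ⊕ (3 · (φ ⟨ Y ⟩) 3 ⊕ 2 · (φ ⟨ Y ⟩) 2) ≈ φ 5 ⊕ (4 · (φ ⟨ Y ⟩) 4 ⊕ (φ ⟨ Y ⟩) 1)
    isolate-φ₅ φ rewrite y₁ | y₂ | y₃ | y₄ | y₅ = solve 6
      (λ p₀ p₁ p₂ p₃ p₄ p₅ →
        let F = series p₀ p₁ p₂ p₃ p₄ p₅ :⟨ :Y ⟩ in
        (F 5 :+ ((3 :· F 3) :+ (2 :· F 2))) := (p₅ :+ ((4 :· F 4) :+ F 1)))
      ≈-refl (φ 0) (φ 1) (φ 2) (φ 3) (φ 4) (φ 5)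

    -- The coefficient of xⁱ in φ(Y) is the value of `y` at i + 1. Thus `isolate-φ₅` reads 20 + 3·4
    -- + 2·2 = φ₅ + 4·9 + 1, that is 36 = φ₅ + 37, and 36 is cancelled.
    φ₅+1≈0 : y 6 ≡ 20 → ∀ φ → Y ≈ₛ (x* (φ ⟨ Y ⟩)) → φ 5 ⊕ 1# ≈ 0#
    φ₅+1≈0 y₆ φ Y≈xφ⟨Y⟩ = +-cancelʳ ring lhs (φ 5 ⊕ 1#) 0# (begin
      (φ 5 ⊕ 1#) ⊕ lhs                              ≈⟨ 4·9+1≈1+lhs ⟨
      φ 5 ⊕ (4 · (9 · 1#) ⊕ 1 · 1#)                 ≈⟨ +-congˡ (+-cong (×-congʳ 4 (coefficient 4 y₅)) (coefficient 1 y₂)) ⟩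
      φ 5 ⊕ (4 · (φ ⟨ Y ⟩) 4 ⊕ (φ ⟨ Y ⟩) 1)          ≈⟨ isolate-φ₅ φ ⟨
      (φ ⟨ Y ⟩) 5 ⊕ (3 · (φ ⟨ Y ⟩) 3 ⊕ 2 · (φ ⟨ Y ⟩) 2) ≈⟨ +-cong (coefficient 5 y₆) (+-cong (×-congʳ 3 (coefficient 3 y₄)) (×-congʳ 2 (coefficient 2 y₃))) ⟨
      lhs                                           ≈⟨ +-identityˡ lhs ⟨
      0# ⊕ lhs                                      ∎)
      where
      open import Algebra.Properties.Monoid.Mult +-monoid using (×-congʳ)
      open import Relation.Binary.Reasoning.Setoid ≈-setoid

      lhs = 20 · 1# ⊕ (3 · (4 · 1#) ⊕ 2 · (2 · 1#))

      coefficient : ∀ i {m} → y (suc i) ≡ m → m · 1# ≈ (φ ⟨ Y ⟩) i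
      coefficient i refl = Y≈xφ⟨Y⟩ (suc i)

      4·9+1≈1+lhs : φ 5 ⊕ (4 · (9 · 1#) ⊕ 1 · 1#) ≈ (φ 5 ⊕ 1#) ⊕ lhs
      4·9+1≈1+lhs = solve 1 (λ p →
        (p :+ ((4 :· (9 :· con 1)) :+ (1 :· con 1)))
        := ((p :+ con 1) :+ ((20 :· con 1) :+ ((3 :· (4 :· con 1)) :+ (2 :· (2 :· con 1))))))
        ≈-refl (φ 5)

  -- Adding 1 to 0 ≤ x gives 1 ≤ x + 1 = 0, which with 0 ≤ 1 forces 1 = 0.
  0≤x⇒x+1≉0 : ∀ {x} → 0# ⊑ x → ¬ x ⊕ 1# ≈ 0#
  0≤x⇒x+1≉0 {x} 0≤x x+1≈0 = 1≉0 (antisym 1≤0 0≤1)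
    where
    open IsPartialOrder isPartialOrder using (antisym; ≤-respʳ-≈; ≤-respˡ-≈)

    1≤0 : 1# ⊑ 0#
    1≤0 = ≤-respʳ-≈ x+1≈0 (≤-respˡ-≈ (+-identityˡ 1#) (+-monoˡ-≤ 1# 0≤x))

mainTheorem1 : ∀ {c ℓ₁ ℓ₂} (R : OrderedCommutativeRing c ℓ₁ ℓ₂) (y : ℕ → ℕ) →
    (∀ n → HasCardinality (PólyaTree n) (y n)) →
    ¬ FormalPowerSeries.SimplyGenerated R y
mainTheorem1 R y card (φ , 0≤φ , Y≈xφ⟨Y⟩) = 0≤x⇒x+1≉0 R (0≤φ 5)
  (φ₅+1≈0 R y (value cardinality₁) (value cardinality₂) (value cardinality₃) (value cardinality₄) (value cardinality₅)
    (value cardinality₆) φ Y≈xφ⟨Y⟩)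
  where
  -- The sequence `y` is known only through cardinalities; their uniqueness turns the computed ones
  -- into values of `y`.
  value : ∀ {n k} → HasCardinality (PólyaTree n) k → y n ≡ k
  value {n} = HasCardinality-unique (card n)
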